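{- For every integer $k\ge 2$, \[ R(H_{2,2k}) = C(H_{2,2k}) - 4 + 2^{2-2k} + 3k\,2^{1-k}, \] and for every integer $k\ge 1$, \[ R(H_{2,2k+1}) = C(H_{2,2k+1}) - 4 + 2^{1-2k} + (2k+1)2^{1-k}. \]
   Context: For a finite simple undirected graph $G$, the closeness is $C(G)=\sum_{i}\sum_{j\ne i}2^{ -d(i,j)}$, where the sum is over all ordered pairs of distinct vertices, $d(i,j)$ is the graph distance, and $2^{ -d(i,j)}=0$ if $i$ and $j$ lie in different components. The link residual closeness is $R(G)=\min_{(r,s)} C(G_{r,s})$, where the minimum is over all edges (links) $(r,s)$ of $G$ and $G_{r,s}$ is the graph obtained from $G$ by deleting the edge $(r,s)$ (keeping all vertices). For $n\ge 3$, the Harary graph $H_{2,n}$ has vertices $1,2,\dots,n$ placed in a circle in this order, each vertex being joined to its nearest vertex in each direction; i.e. $H_{2,n}$ is the cycle graph $C_n$. -}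

module Defs where

open import Level using (0ℓ)
open import Data.Nat.Base as ℕ using (ℕ; zero; suc; s≤s; s≤s⁻¹; z≤n)
import Data.Nat.Properties as ℕ
open import Data.Nat.Induction using (<-rec)
open import Data.Integer.Base as ℤ using (ℤ; +_; -[1+_])
open import Data.Rational.Base using (ℚ; 0ℚ; ½; _/_; +-*-rawSemiring)
open import Data.Rational.Properties
  using (+-0-commutativeMonoid; ≤-decTotalOrder)
open import Data.Fin.Base using (Fin; zero; suc; toℕ)
open import Data.Fin.Properties using (_≟_; any?; pigeonhole; toℕ≤pred[n])
open import Data.List.Base using (List; []; _∷_; map; filter; allFin; cartesianProduct)
open import Data.Maybe.Base using (Maybe; just; nothing)
open import Data.Product.Base using (∃; _×_; _,_; uncurry)
open import Data.Sum.Base as Sum using (_⊎_; inj₁; inj₂)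
open import Function.Base using (_∘_)
open import Relation.Binary.Bundles using (DecTotalOrder)
open import Relation.Binary.Core using (Rel)
open import Relation.Binary.Definitions
  using (Decidable; Symmetric; Irreflexive)
open import Relation.Binary.PropositionalEquality
  using (_≡_; refl; sym; trans; cong; subst)
open import Relation.Nullary using (¬_; Dec; yes; no; contradiction)
open import Relation.Nullary.Decidable as Dec using (_×-dec_; _⊎-dec_; ¬?)
import Relation.Unary as U

open import Algebra.Definitions.RawSemiring +-*-rawSemiring using (_^_)
open import Algebra.Properties.CommutativeMonoid.Sum +-0-commutativeMonoid
  using (sum)
open import Data.List.Extrema (DecTotalOrder.totalOrder ≤-decTotalOrder)
  using (min)

fromℕ : ℕ → ℚ
fromℕ n = + n / 1

infix 9 2^_

2^_ : ℤ → ℚ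
2^ (+ n)    = fromℕ 2 ^ n
2^ -[1+ n ] = ½ ^ suc n

record Graph (n : ℕ) : Set₁ where
  field
    Adj    : Rel (Fin n) 0ℓ
    adj?   : Decidable Adj
    symm   : Symmetric Adj
    irrefl : Irreflexive _≡_ Adj

open Graph public

private
  variable
    n d e : ℕ
    i j k : Fin n

infixr 5 _∷_ _++_

data Walk (G : Graph n) : Fin n → Fin n → ℕ → Set where
  []  : Walk G i i 0
  _∷_ : Adj G i j → Walk G j k d → Walk G i k (suc d)

Connected : Graph n → Fin n → Fin n → Set
Connected G i j = ∃ λ d → Walk G i j d

IsDistance : Graph n → Fin n → Fin n → ℕ → Set
IsDistance G i j d = Walk G i j d × (∀ e → Walk G i j e → d ℕ.≤ e)

private
  walk? : (G : Graph n) (i j : Fin n) → U.Decidable (Walk G i j)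
  walk? G i j zero    = Dec.map′ (λ { refl → [] }) (λ { [] → refl }) (i ≟ j)
  walk? G i j (suc d) =
    Dec.map′ (λ { (_ , a , w) → a ∷ w }) (λ { (a ∷ w) → _ , a , w })
      (any? λ k → adj? G i k ×-dec walk? G k j d)

  least : {P : ℕ → Set} → U.Decidable P → ∀ d → P d →
          ∃ λ m → P m × (∀ e → P e → m ℕ.≤ e)
  least {P} P? =
    <-rec (λ d → P d → ∃ λ m → P m × (∀ e → P e → m ℕ.≤ e)) step
    where
    step : ∀ d → (∀ {c} → c ℕ.< d → P c → _) → P d → _
    step d rec p with ℕ.anyUpTo? P? d
    ... | yes (c , c<d , q) = rec c<d q
    ... | no  ¬q = d , p , λ e q → ℕ.≮⇒≥ λ e<d → ¬q (e , e<d , q)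

  _++_ : {G : Graph n} → Walk G i j d → Walk G j k e → Walk G i k (d ℕ.+ e)
  []      ++ v = v
  (a ∷ w) ++ v = a ∷ (w ++ v)

  vertexAt : {G : Graph n} → Walk G i j d → Fin (suc d) → Fin n
  vertexAt {i = i} w       zero    = i
  vertexAt         (_ ∷ w) (suc a) = vertexAt w a

  takeWalk : {G : Graph n} (w : Walk G i j d) (a : Fin (suc d)) →
             Walk G i (vertexAt w a) (toℕ a)
  takeWalk w       zero    = []
  takeWalk (x ∷ w) (suc a) = x ∷ takeWalk w a

  dropWalk : {G : Graph n} (w : Walk G i j d) (a : Fin (suc d)) →
             Walk G (vertexAt w a) j (d ℕ.∸ toℕ a)
  dropWalk w       zero    = w
  dropWalk (_ ∷ w) (suc a) = dropWalk w a

  shorten : {G : Graph n} → n ℕ.≤ d → Walk G i j d →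
            ∃ λ e → e ℕ.< d × Walk G i j e
  shorten {d = d} {j = j} {G = G} n≤d w
    with a , b , a<b , eq ← pigeonhole (s≤s n≤d) (vertexAt w)
    = toℕ a ℕ.+ (d ℕ.∸ toℕ b)
    , subst (toℕ a ℕ.+ (d ℕ.∸ toℕ b) ℕ.<_)
        (ℕ.m+[n∸m]≡n (toℕ≤pred[n] b)) (ℕ.+-monoˡ-< (d ℕ.∸ toℕ b) a<b)
    , takeWalk w a ++ subst (λ v → Walk G v j _) (sym eq) (dropWalk w b)

distance : (G : Graph n) (i j : Fin n) →
           ∃ (IsDistance G i j) ⊎ ¬ Connected G i j
distance {n} G i j with ℕ.anyUpTo? (walk? G i j) n
... | yes (d , _ , w) = inj₁ (least (walk? G i j) d w)
... | no  ¬short      = inj₂ disconnected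
  where
  disconnected : ¬ Connected G i j
  disconnected (d , w) with least (walk? G i j) d w
  ... | m , v , m≤ with m ℕ.<? n
  ...   | yes m<n = ¬short (m , m<n , v)
  ...   | no  m≮n with e , e<m , u ← shorten (ℕ.≮⇒≥ m≮n) v
                  = ℕ.<⇒≱ e<m (m≤ e u)

2^-distance : (G : Graph n) → Fin n → Fin n → ℚ
2^-distance G i j with distance G i j
... | inj₁ (d , _) = 2^ (ℤ.- + d)
... | inj₂ _       = 0ℚ

pairCloseness : Graph n → Fin n → Fin n → ℚ
pairCloseness G i j with i ≟ j
... | yes _ = 0ℚ
... | no  _ = 2^-distance G i j

C : Graph n → ℚ
C G = sum λ i → sum λ j → pairCloseness G i j

Joins : Fin n × Fin n → Rel (Fin n) 0ℓ
Joins (r , s) i j = (i ≡ r × j ≡ s) ⊎ (i ≡ s × j ≡ r)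

joins? : (rs : Fin n × Fin n) → Decidable (Joins rs)
joins? (r , s) i j = (i ≟ r ×-dec j ≟ s) ⊎-dec (i ≟ s ×-dec j ≟ r)

joins-symm : (rs : Fin n × Fin n) → Symmetric (Joins rs)
joins-symm rs (inj₁ (p , q)) = inj₂ (q , p)
joins-symm rs (inj₂ (p , q)) = inj₁ (q , p)

infixl 6 _∖_

_∖_ : Graph n → Fin n × Fin n → Graph n
G ∖ rs = record
  { Adj    = λ i j → Adj G i j × ¬ Joins rs i j
  ; adj?   = λ i j → adj? G i j ×-dec ¬? (joins? rs i j)
  ; symm   = λ { (a , ¬rs) → symm G a , ¬rs ∘ joins-symm rs }
  ; irrefl = λ { eq (a , _) → irrefl G eq a }
  }

-- Every edge is listed in both orientations; this does not affect a minimum.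
edges : Graph n → List (Fin n × Fin n)
edges {n} G = filter (uncurry (adj? G)) (cartesianProduct (allFin n) (allFin n))

minimum : List ℚ → Maybe ℚ
minimum []       = nothing
minimum (x ∷ xs) = just (min x xs)

-- The minimum over the links is undefined for a graph without links.
R : Graph n → Maybe ℚ
R G = minimum (map (λ rs → C (G ∖ rs)) (edges G))

-- The vertex after i on the circle is the one labelled toℕ i + 1, except that
-- the last vertex is followed by the one labelled 0.
Next : Rel (Fin n) 0ℓ
Next {n} i j = suc (toℕ i) ≡ toℕ j ⊎ (suc (toℕ i) ≡ n × toℕ j ≡ 0)

H₂ : (n : ℕ) → 3 ℕ.≤ n → Graph n
H₂ n 3≤n = record
  { Adj    = λ i j → Next i j ⊎ Next j i
  ; adj?   = λ i j → next? i j ⊎-dec next? j i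
  ; symm   = Sum.swap
  ; irrefl = λ { refl (inj₁ p) → next-irrefl p ; refl (inj₂ p) → next-irrefl p }
  }
  where
  next? : Decidable (Next {n})
  next? i j = (suc (toℕ i) ℕ.≟ toℕ j)
         ⊎-dec ((suc (toℕ i) ℕ.≟ n) ×-dec (toℕ j ℕ.≟ 0))

  next-irrefl : {i : Fin n} → ¬ Next i i
  next-irrefl (inj₁ p) = ℕ.1+n≢n p
  next-irrefl (inj₂ (p , q)) =
    contradiction (subst (3 ℕ.≤_) (trans (sym p) (cong suc q)) 3≤n) λ { (s≤s ()) }

3≤2k : ∀ {k} → 2 ℕ.≤ k → 3 ℕ.≤ 2 ℕ.* k
3≤2k 2≤k = ℕ.≤-trans (ℕ.n≤1+n 3) (ℕ.*-monoʳ-≤ 2 2≤k)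

3≤2k+1 : ∀ {k} → 1 ℕ.≤ k → 3 ℕ.≤ 2 ℕ.* k ℕ.+ 1
3≤2k+1 1≤k = ℕ.+-monoˡ-≤ 1 (ℕ.*-monoʳ-≤ 2 1≤k)

{-# OPTIONS --safe #-}
module Submission where

-- Rotations act transitively on the edges of the cycle, so every edge deletion
-- has the closeness of the path on 0, …, n − 1, and the minimum is over a
-- constant list. In the path d(i, j) = |i − j|, whence C = 2n − 4 + 2^{2−n}.
-- By rotation all columns of the cycle's double sum agree with column 0, where
-- d(i, 0) = min(i, n − i); that sum is evaluated by peeling off the equal
-- terms at its two ends.

open import Defs
open import Data.Nat.Base as ℕ using (ℕ; zero; suc; s≤s; z≤n; _⊓_; _∸_; ∣_-_∣)
import Data.Nat.Properties as ℕ
open import Data.Integer.Base as ℤ using (+_)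
import Data.Integer.Properties as ℤ
open import Data.Rational.Base using (ℚ; 0ℚ; 1ℚ; ½; toℚᵘ; _+_; _-_; _*_; +-*-rawSemiring)
open import Data.Rational.Properties
  using ( +-0-commutativeMonoid; +-identityˡ; *-zeroˡ
        ; toℚᵘ-injective; toℚᵘ-fromℚᵘ; toℚᵘ-homo-+; ≤-decTotalOrder )
import Data.Rational.Unnormalised.Base as ℚᵘ
import Data.Rational.Unnormalised.Properties as ℚᵘ
open import Data.Rational.Solver using (module +-*-Solver)
open import Data.Fin.Base using (Fin; zero; suc; toℕ; fromℕ<; inject₁)
  renaming (fromℕ to last)
open import Data.Fin.Induction using (<-weakInduction; >-weakInduction)
open import Data.Fin.Permutation as Perm
  using (Permutation′; permutation; _⟨$⟩ʳ_; _⟨$⟩ˡ_)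
open import Data.Fin.Properties
  using (_≟_; toℕ-injective; toℕ-fromℕ; toℕ-fromℕ<; toℕ-inject₁; toℕ<n; toℕ≤pred[n])
open import Data.Fin.Relation.Unary.Top
  using (view; view-fromℕ; view-inject₁; ‵fromℕ; ‵inject₁)
open import Data.List.Base using (List; []; _∷_; allFin; cartesianProduct)
open import Data.List.Membership.Propositional using (_∈_)
open import Data.List.Membership.Propositional.Properties
  using (∈-map⁺; ∈-filter⁺; ∈-cartesianProduct⁺; ∈-allFin)
open import Data.List.Relation.Unary.All as All using (All; []; _∷_)
open import Data.List.Relation.Unary.All.Properties as All using (all-filter)
open import Data.Maybe.Base using (just)
open import Data.Product.Base using (_×_; _,_; proj₁; proj₂; uncurry)
open import Data.Sum.Base as Sum using (_⊎_; inj₁; inj₂)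
open import Function.Base using (id; _∘_)
open import Function.Bundles using (Injection)
open import Function.Properties.Inverse using (↔⇒↣)
open import Relation.Binary.Bundles using (DecTotalOrder)
open import Relation.Binary.PropositionalEquality
  using (_≡_; refl; sym; trans; cong; cong₂; subst; subst₂; module ≡-Reasoning)
open import Relation.Nullary using (¬_; yes; no; contradiction)

open import Algebra.Definitions.RawSemiring +-*-rawSemiring using (_^_)
open import Algebra.Properties.CommutativeMonoid.Sum +-0-commutativeMonoid
  using (sum; sum-cong-≗; sum-permute; sum-init-last; ∑-comm; ∑-distrib-+)
open import Data.List.Extrema (DecTotalOrder.totalOrder ≤-decTotalOrder)
  using (argmin-sel)

private
  variable
    m n d e : ℕ
    i j k : Fin n
    G H : Graph n

-- Rational arithmetic

-- Normalisation blocks `+ n / 1` from computing for a variable `n`. Over the unnormalised rationals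
-- both denominators are 1, and only factors 1 in the numerators remain to be removed.
fromℕ-homo-+ : ∀ m n → fromℕ (m ℕ.+ n) ≡ fromℕ m + fromℕ n
fromℕ-homo-+ m n = toℚᵘ-injective (begin
  toℚᵘ (fromℕ (m ℕ.+ n))               ≈⟨ toℚᵘ-fromℚᵘ _ ⟩
  ℚᵘ.mkℚᵘ (+ (m ℕ.+ n)) 0
    ≡⟨ cong (λ z → ℚᵘ.mkℚᵘ z 0)
         (cong₂ ℤ._+_ (sym (ℤ.*-identityʳ (+ m))) (sym (ℤ.*-identityʳ (+ n)))) ⟩
  ℚᵘ.mkℚᵘ (+ m) 0 ℚᵘ.+ ℚᵘ.mkℚᵘ (+ n) 0
    ≈⟨ ℚᵘ.+-cong (toℚᵘ-fromℚᵘ (ℚᵘ.mkℚᵘ (+ m) 0)) (toℚᵘ-fromℚᵘ (ℚᵘ.mkℚᵘ (+ n) 0)) ⟨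
  toℚᵘ (fromℕ m) ℚᵘ.+ toℚᵘ (fromℕ n)   ≈⟨ toℚᵘ-homo-+ (fromℕ m) (fromℕ n) ⟨
  toℚᵘ (fromℕ m + fromℕ n)             ∎)
  where open ℚᵘ.≃-Reasoning

sum-const : ∀ n x → sum {n} (λ _ → x) ≡ fromℕ n * x
sum-const zero    x = sym (*-zeroˡ x)
sum-const (suc n) x = begin
  x + sum {n} (λ _ → x)    ≡⟨ cong (λ z → x + z) (sum-const n x) ⟩
  x + fromℕ n * x          ≡⟨ solve 2 (λ x k → x :+ k :* x := (con 1ℚ :+ k) :* x) refl x (fromℕ n) ⟩
  (1ℚ + fromℕ n) * x       ≡⟨ cong (_* x) (fromℕ-homo-+ 1 n) ⟨
  fromℕ (suc n) * x        ∎
  where open ≡-Reasoning; open +-*-Solver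

-- `2^_` is defined by the constructor of its exponent, and only from `n = 2` on does `+ 1 ℤ.- + n`
-- reduce to a negative one; the smaller cases are closed computations.
2^[1-n] : ∀ n → 2^ (+ 1 ℤ.- + n) ≡ fromℕ 2 * ½ ^ n
2^[1-n] 0             = refl
2^[1-n] 1             = refl
2^[1-n] (suc (suc n)) =
  solve 1 (λ x → con ½ :* x := con (fromℕ 2) :* (con ½ :* (con ½ :* x))) refl (½ ^ n)
  where open +-*-Solver

2^[2-n] : ∀ n → 2^ (+ 2 ℤ.- + n) ≡ fromℕ 4 * ½ ^ n
2^[2-n] 0                   = refl
2^[2-n] 1                   = refl
2^[2-n] 2                   = refl
2^[2-n] (suc (suc (suc n))) =
  solve 1 (λ x → con ½ :* x := con (fromℕ 4) :* (con ½ :* (con ½ :* (con ½ :* x)))) refl (½ ^ n)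
  where open +-*-Solver

-- Extending the contribution 2^{-d} of a pair by 0 at d = 0 absorbs the
-- condition i ≠ j of the double sum.
weight : ℕ → ℚ
weight zero    = 0ℚ
weight (suc d) = ½ ^ suc d

-- This geometric series is what vertex 0 of a path contributes to its row. Splitting off the last
-- term, not the first, keeps the summand in the shape of the induction hypothesis.
sum-weight-suc : ∀ n → sum {n} (λ i → weight (suc (toℕ i))) ≡ 1ℚ - ½ ^ n
sum-weight-suc zero    = refl
sum-weight-suc (suc n) = begin
  sum {suc n} (λ i → weight (suc (toℕ i)))  ≡⟨ sum-init-last {n} (λ i → weight (suc (toℕ i))) ⟩
  sum {n} (λ i → weight (suc (toℕ (inject₁ i)))) + weight (suc (toℕ (last n)))
    ≡⟨ cong₂ _+_ (sum-cong-≗ {n} λ i → cong (weight ∘ suc) (toℕ-inject₁ i))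
                 (cong (weight ∘ suc) (toℕ-fromℕ n)) ⟩
  sum {n} (λ i → weight (suc (toℕ i))) + ½ ^ suc n
    ≡⟨ cong (_+ ½ ^ suc n) (sum-weight-suc n) ⟩
  (1ℚ - ½ ^ n) + ½ * ½ ^ n
    ≡⟨ solve 1 (λ x → (con 1ℚ :- x) :+ con ½ :* x := con 1ℚ :- con ½ :* x) refl (½ ^ n) ⟩
  1ℚ - ½ * ½ ^ n ∎
  where open ≡-Reasoning; open +-*-Solver

pathSum : ℕ → ℚ
pathSum n = sum {n} λ i → sum {n} λ j → weight ∣ toℕ i - toℕ j ∣

-- Induction by removing vertex 0: its row and its column contribute the same geometric series, and
-- the remaining block is `pathSum n` because `∣ suc i - suc j ∣` reduces to `∣ i - j ∣`.
pathSum-closed : ∀ n → pathSum n ≡ fromℕ 2 * fromℕ n - fromℕ 4 + fromℕ 4 * ½ ^ n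
pathSum-closed zero    = refl
pathSum-closed (suc n) = begin
  (0ℚ + row) + sum {n} (λ i → weight (suc (toℕ i)) + sum {n} λ j → weight ∣ toℕ i - toℕ j ∣)
    ≡⟨ cong (λ z → (0ℚ + row) + z) (∑-distrib-+ {n} _ _) ⟩
  (0ℚ + row) + (row + pathSum n)
    ≡⟨ cong₂ (λ r p → (0ℚ + r) + (r + p)) (sum-weight-suc n) (pathSum-closed n) ⟩
  (0ℚ + (1ℚ - x)) + ((1ℚ - x) + (fromℕ 2 * N - fromℕ 4 + fromℕ 4 * x))
    ≡⟨ solve 2 (λ x N →
         (con 0ℚ :+ (con 1ℚ :- x)) :+ ((con 1ℚ :- x) :+ (con (fromℕ 2) :* N :- con (fromℕ 4) :+ con (fromℕ 4) :* x))
         := con (fromℕ 2) :* (con 1ℚ :+ N) :- con (fromℕ 4) :+ con (fromℕ 4) :* (con ½ :* x)) refl x N ⟩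
  fromℕ 2 * (1ℚ + N) - fromℕ 4 + fromℕ 4 * (½ * x)
    ≡⟨ cong (λ z → fromℕ 2 * z - fromℕ 4 + fromℕ 4 * (½ * x)) (fromℕ-homo-+ 1 n) ⟨
  fromℕ 2 * fromℕ (suc n) - fromℕ 4 + fromℕ 4 * ½ ^ suc n ∎
  where
  open ≡-Reasoning; open +-*-Solver
  x N row : ℚ
  x = ½ ^ n
  N = fromℕ n
  row = sum {n} λ i → weight (suc (toℕ i))

-- The distances a, a+1, …, a+1, a read off along an arc of m vertices.
arcSum : ℕ → ℕ → ℚ
arcSum a m = sum {m} λ i → weight ((a ℕ.+ toℕ i) ⊓ (a ℕ.+ m ∸ suc (toℕ i)))

-- The minimum equals `a` at both ends, through its left operand at the first index and its right
-- operand at the last. In between, the index shift by one is absorbed into `suc a`.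
arcSum-peel : ∀ a m → arcSum a (2 ℕ.+ m) ≡ weight a + (arcSum (suc a) m + weight a)
arcSum-peel a m = cong₂ _+_ (cong weight first)
  (trans (sum-init-last {m} λ i → term (suc i))
    (cong₂ _+_ (sum-cong-≗ {m} λ i → cong weight (inner i)) (cong weight final)))
  where
  open ≡-Reasoning

  term : Fin (2 ℕ.+ m) → ℚ
  term i = weight ((a ℕ.+ toℕ i) ⊓ (a ℕ.+ (2 ℕ.+ m) ∸ suc (toℕ i)))

  a+2+m : a ℕ.+ suc (suc m) ≡ suc (suc (a ℕ.+ m))
  a+2+m = trans (ℕ.+-suc a (suc m)) (cong suc (ℕ.+-suc a m))

  first : (a ℕ.+ 0) ⊓ (a ℕ.+ suc (suc m) ∸ 1) ≡ a
  first = begin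
    (a ℕ.+ 0) ⊓ (a ℕ.+ suc (suc m) ∸ 1)
      ≡⟨ cong₂ (λ x y → x ⊓ (y ∸ 1)) (ℕ.+-identityʳ a) a+2+m ⟩
    a ⊓ suc (a ℕ.+ m)  ≡⟨ ℕ.m≤n⇒m⊓n≡m (ℕ.m≤n⇒m≤1+n (ℕ.m≤m+n a m)) ⟩
    a                  ∎

  inner : ∀ (i : Fin m) →
    (a ℕ.+ suc (toℕ (inject₁ i))) ⊓ (a ℕ.+ suc (suc m) ∸ suc (suc (toℕ (inject₁ i)))) ≡
    (suc a ℕ.+ toℕ i) ⊓ (suc a ℕ.+ m ∸ suc (toℕ i))
  inner i rewrite toℕ-inject₁ i | a+2+m | ℕ.+-suc a (toℕ i) = refl

  final : (a ℕ.+ suc (toℕ (last m))) ⊓ (a ℕ.+ suc (suc m) ∸ suc (suc (toℕ (last m)))) ≡ a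
  final rewrite toℕ-fromℕ m | a+2+m | ℕ.m+n∸n≡m a m =
    ℕ.m≥n⇒m⊓n≡n (ℕ.m≤m+n a (suc m))

-- Each of the distances `a + 1`, ..., `a + t` occurs twice, giving two geometric series. The arc
-- omits vertex 0, so even arcs belong to odd cycles.
arcSum-even : ∀ a t → arcSum (suc a) (t ℕ.+ t) ≡ fromℕ 2 * (½ ^ a - ½ ^ (a ℕ.+ t))
arcSum-even a zero    rewrite ℕ.+-identityʳ a =
  solve 1 (λ x → con 0ℚ := con (fromℕ 2) :* (x :- x)) refl (½ ^ a)
  where open +-*-Solver
arcSum-even a (suc t) rewrite ℕ.+-suc t t | ℕ.+-suc a t = begin
  arcSum (suc a) (2 ℕ.+ (t ℕ.+ t))  ≡⟨ arcSum-peel (suc a) (t ℕ.+ t) ⟩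
  ½ ^ suc a + (arcSum (suc (suc a)) (t ℕ.+ t) + ½ ^ suc a)
    ≡⟨ cong (λ z → ½ ^ suc a + (z + ½ ^ suc a)) (arcSum-even (suc a) t) ⟩
  ½ * ½ ^ a + (fromℕ 2 * (½ * ½ ^ a - ½ * ½ ^ (a ℕ.+ t)) + ½ * ½ ^ a)
    ≡⟨ solve 2 (λ x y →
         con ½ :* x :+ (con (fromℕ 2) :* (con ½ :* x :- con ½ :* y) :+ con ½ :* x)
         := con (fromℕ 2) :* (x :- con ½ :* y)) refl (½ ^ a) (½ ^ (a ℕ.+ t)) ⟩
  fromℕ 2 * (½ ^ a - ½ ^ suc (a ℕ.+ t)) ∎
  where open ≡-Reasoning; open +-*-Solver

-- The middle distance `a + t + 1` occurs once and all others twice. Doubling the whole series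
-- subtracts `½ ^ suc (a + t)` twice, and correcting for the middle term subtracts it a third time.
arcSum-odd : ∀ a t → arcSum (suc a) (suc (t ℕ.+ t)) ≡
             fromℕ 2 * ½ ^ a - fromℕ 3 * ½ ^ suc (a ℕ.+ t)
arcSum-odd a zero    rewrite ℕ.+-identityʳ a | ℕ.+-comm a 1 | ℕ.⊓-idem a =
  solve 1 (λ x → con ½ :* x :+ con 0ℚ := con (fromℕ 2) :* x :- con (fromℕ 3) :* (con ½ :* x))
    refl (½ ^ a)
  where open +-*-Solver
arcSum-odd a (suc t) rewrite ℕ.+-suc t t | ℕ.+-suc a t = begin
  arcSum (suc a) (2 ℕ.+ suc (t ℕ.+ t))  ≡⟨ arcSum-peel (suc a) (suc (t ℕ.+ t)) ⟩
  ½ ^ suc a + (arcSum (suc (suc a)) (suc (t ℕ.+ t)) + ½ ^ suc a)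
    ≡⟨ cong (λ z → ½ ^ suc a + (z + ½ ^ suc a)) (arcSum-odd (suc a) t) ⟩
  ½ * ½ ^ a + ((fromℕ 2 * (½ * ½ ^ a) - fromℕ 3 * (½ * y)) + ½ * ½ ^ a)
    ≡⟨ solve 2 (λ x y →
         con ½ :* x :+ ((con (fromℕ 2) :* (con ½ :* x) :- con (fromℕ 3) :* (con ½ :* y)) :+ con ½ :* x)
         := con (fromℕ 2) :* x :- con (fromℕ 3) :* (con ½ :* y)) refl (½ ^ a) y ⟩
  fromℕ 2 * ½ ^ a - fromℕ 3 * ½ ^ suc (suc (a ℕ.+ t)) ∎
  where
  open ≡-Reasoning; open +-*-Solver
  y : ℚ
  y = ½ ^ suc (a ℕ.+ t)

-- Walks and distances

snocWalk : Walk G i j d → Adj G j k → Walk G i k (suc d)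
snocWalk []      b = b ∷ []
snocWalk (a ∷ w) b = a ∷ snocWalk w b

reverseWalk : Walk G i j d → Walk G j i d
reverseWalk         []      = []
reverseWalk {G = G} (a ∷ w) = snocWalk (reverseWalk w) (symm G a)

ascend : (∀ {i j} → suc (toℕ i) ≡ toℕ j → Adj G i j) →
         ∀ d → toℕ i ℕ.+ d ≡ toℕ j → Walk G i j d
ascend {G = G} {i = i} adj zero eq =
  subst (λ v → Walk G i v 0) (toℕ-injective (trans (sym (ℕ.+-identityʳ _)) eq)) []
ascend {n} {i = i} {j = j} adj (suc d) eq =
  -- The vertex labelled `toℕ i + 1` exists because its label is at most `toℕ j`.
  adj (sym (toℕ-fromℕ< i+1<n)) ∷ ascend adj d (trans (cong (ℕ._+ d) (toℕ-fromℕ< i+1<n)) eq′)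
  where
  eq′ : suc (toℕ i) ℕ.+ d ≡ toℕ j
  eq′ = trans (sym (ℕ.+-suc (toℕ i) d)) eq

  i+1<n : suc (toℕ i) ℕ.< n
  i+1<n = ℕ.≤-<-trans (subst (suc (toℕ i) ℕ.≤_) eq′ (ℕ.m≤m+n _ d)) (toℕ<n j)

2^-distance-connected : IsDistance G i j d → 2^-distance G i j ≡ 2^ (ℤ.- + d)
2^-distance-connected {G = G} {i = i} {j = j} {d = d} (w , least) with distance G i j
... | inj₁ (e , v , least′) = cong (λ d → 2^ (ℤ.- + d)) (ℕ.≤-antisym (least′ d w) (least e v))
... | inj₂ ¬conn            = contradiction (d , w) ¬conn

2^-distance-disconnected : ¬ Connected G i j → 2^-distance G i j ≡ 0ℚ
2^-distance-disconnected {G = G} {i = i} {j = j} ¬conn with distance G i j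
... | inj₁ (d , w , _) = contradiction (d , w) ¬conn
... | inj₂ _           = refl

-- The test `i ≟ j` agrees with `d = 0`: the empty walk bounds the distance from a vertex to itself
-- by 0, and a walk of length 0 has equal ends.
pairCloseness-weight : IsDistance G i j d → pairCloseness G i j ≡ weight d
pairCloseness-weight {i = i} {j = j} {d = d} D with i ≟ j
pairCloseness-weight {d = zero}  D           | yes _    = refl
pairCloseness-weight {d = suc d} (_ , least) | yes refl = contradiction (least 0 []) λ ()
pairCloseness-weight {d = zero}  ([] , _)    | no i≢i   = contradiction refl i≢i
pairCloseness-weight {d = suc d} D           | no _     = 2^-distance-connected D

-- Isomorphism invariance

Hom : Graph n → Graph n → (Fin n → Fin n) → Set
Hom G H f = ∀ {i j} → Adj G i j → Adj H (f i) (f j)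

Iso : Graph n → Graph n → Permutation′ n → Set
Iso G H π = Hom G H (π ⟨$⟩ʳ_) × Hom H G (π ⟨$⟩ˡ_)

mapWalk : ∀ {f} → Hom G H f → Walk G i j d → Walk H (f i) (f j) d
mapWalk h []      = []
mapWalk h (a ∷ w) = h a ∷ mapWalk h w

module _ {G H : Graph n} (π : Permutation′ n) (iso : Iso G H π) where

  private
    π-injective : ∀ {i j} → π ⟨$⟩ʳ i ≡ π ⟨$⟩ʳ j → i ≡ j
    π-injective = Injection.injective (↔⇒↣ π)

  reflectWalk : Walk H (π ⟨$⟩ʳ i) (π ⟨$⟩ʳ j) d → Walk G i j d
  reflectWalk w = subst₂ (λ i j → Walk G i j _) (Perm.inverseˡ π) (Perm.inverseˡ π)
                    (mapWalk (proj₂ iso) w)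

  2^-distance-iso : ∀ i j → 2^-distance G i j ≡ 2^-distance H (π ⟨$⟩ʳ i) (π ⟨$⟩ʳ j)
  2^-distance-iso i j with distance G i j
  ... | inj₁ (d , w , least) = sym (2^-distance-connected
          (mapWalk (proj₁ iso) w , λ e v → least e (reflectWalk v)))
  ... | inj₂ ¬conn = sym (2^-distance-disconnected λ (d , v) → ¬conn (d , reflectWalk v))

  pairCloseness-iso : ∀ i j → pairCloseness G i j ≡ pairCloseness H (π ⟨$⟩ʳ i) (π ⟨$⟩ʳ j)
  pairCloseness-iso i j with i ≟ j | (π ⟨$⟩ʳ i) ≟ (π ⟨$⟩ʳ j)
  ... | yes _   | yes _  = refl
  ... | yes i≡j | no ≢   = contradiction (cong (π ⟨$⟩ʳ_) i≡j) ≢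
  ... | no i≢j  | yes ≡′ = contradiction (π-injective ≡′) i≢j
  ... | no _    | no _   = 2^-distance-iso i j

  C-iso : C G ≡ C H
  C-iso = begin
    (sum λ i → sum λ j → pairCloseness G i j)
      ≡⟨ sum-cong-≗ (λ i → sum-cong-≗ (pairCloseness-iso i)) ⟩
    (sum λ i → sum λ j → pairCloseness H (π ⟨$⟩ʳ i) (π ⟨$⟩ʳ j))
      ≡⟨ sum-cong-≗ (λ i → sum-permute (pairCloseness H (π ⟨$⟩ʳ i)) π) ⟨
    (sum λ i → sum λ j → pairCloseness H (π ⟨$⟩ʳ i) j)
      ≡⟨ sum-permute (λ i → sum λ j → pairCloseness H i j) π ⟨
    (sum λ i → sum λ j → pairCloseness H i j) ∎
    where open ≡-Reasoning

  -- Adjacency after deletion contains a negation, so `Joins` must be carried against the direction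
  -- of the map: by injectivity for `π`, by cancellation for its inverse.
  ∖-iso : ∀ r s → Iso (G ∖ (r , s)) (H ∖ (π ⟨$⟩ʳ r , π ⟨$⟩ʳ s)) π
  ∖-iso r s = (λ { (a , ¬rs) → proj₁ iso a , ¬rs ∘ Sum.map back back })
            , (λ { (a , ¬rs) → proj₂ iso a , ¬rs ∘ Sum.map forth forth })
    where
    back : ∀ {i j r s} → π ⟨$⟩ʳ i ≡ π ⟨$⟩ʳ r × π ⟨$⟩ʳ j ≡ π ⟨$⟩ʳ s → i ≡ r × j ≡ s
    back (p , q) = π-injective p , π-injective q

    forth : ∀ {i j r s} → π ⟨$⟩ˡ i ≡ r × π ⟨$⟩ˡ j ≡ s → i ≡ π ⟨$⟩ʳ r × j ≡ π ⟨$⟩ʳ s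
    forth (refl , refl) = sym (Perm.inverseʳ π) , sym (Perm.inverseʳ π)

-- The two graphs are distinct terms with equivalent adjacency, so the identity permutation is an
-- isomorphism between them.
C-∖-swap : ∀ (G : Graph n) r s → C (G ∖ (r , s)) ≡ C (G ∖ (s , r))
C-∖-swap G r s = C-iso {G = G ∖ (r , s)} {H = G ∖ (s , r)} Perm.id
  ( (λ { (a , ¬rs) → a , ¬rs ∘ Sum.swap })
  , (λ { (a , ¬rs) → a , ¬rs ∘ Sum.swap }) )

-- Rotation of the circle

next : Fin (suc m) → Fin (suc m)
next i with view i
... | ‵fromℕ     = zero
... | ‵inject₁ i = suc i

prev : Fin (suc m) → Fin (suc m)
prev zero    = last _
prev (suc i) = inject₁ i

next-last : ∀ m → next (last m) ≡ zero
next-last m rewrite view-fromℕ m = refl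

next-inject₁ : ∀ (i : Fin m) → next (inject₁ i) ≡ suc i
next-inject₁ i rewrite view-inject₁ i = refl

next-prev : ∀ (i : Fin (suc m)) → next (prev i) ≡ i
next-prev zero    = next-last _
next-prev (suc i) = next-inject₁ i

prev-next : ∀ (i : Fin (suc m)) → prev (next i) ≡ i
prev-next i with view i
... | ‵fromℕ     = refl
... | ‵inject₁ i = refl

rotation : Permutation′ (suc m)
rotation = permutation next prev next-prev prev-next

Next-next : ∀ (i : Fin (suc m)) → Next i (next i)
Next-next i with view i
... | ‵fromℕ     = inj₂ (cong suc (toℕ-fromℕ _) , refl)
... | ‵inject₁ i = inj₁ (cong suc (toℕ-inject₁ i))

-- The two clauses of `Next` exclude each other: one makes `suc (toℕ i)` a label, hence less than
-- `n`, the other makes it `n`.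
Next-functional : Next i j → Next i k → j ≡ k
Next-functional (inj₁ p) (inj₁ q) = toℕ-injective (trans (sym p) q)
Next-functional (inj₂ (_ , p)) (inj₂ (_ , q)) = toℕ-injective (trans p (sym q))
Next-functional {j = j} (inj₁ p) (inj₂ (q , _)) =
  contradiction (trans (sym p) q) (ℕ.<⇒≢ (toℕ<n j))
Next-functional {k = k} (inj₂ (q , _)) (inj₁ p) =
  contradiction (trans (sym p) q) (ℕ.<⇒≢ (toℕ<n k))

Next⇒next : ∀ {i j : Fin (suc m)} → Next i j → next i ≡ j
Next⇒next {i = i} = Next-functional (Next-next i)

rotation-iso : ∀ (3≤n : 3 ℕ.≤ suc m) → Iso (H₂ (suc m) 3≤n) (H₂ (suc m) 3≤n) rotation
rotation-iso _ = Sum.map next-Next next-Next , Sum.map prev-Next prev-Next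
  where
  next-Next : ∀ {i j} → Next i j → Next (next i) (next j)
  next-Next {i} p with refl ← Next⇒next p = Next-next (next i)

  prev-Next : ∀ {i j} → Next i j → Next (prev i) (prev j)
  prev-Next {i} p with refl ← Next⇒next p =
    subst (Next (prev i)) (trans (next-prev i) (sym (prev-next i))) (Next-next (prev i))

-- The cycle and its edge-deleted subgraphs

module _ (3≤n : 3 ℕ.≤ suc m) where

  private
    cycle path : Graph (suc m)
    cycle = H₂ (suc m) 3≤n
    path  = cycle ∖ (last m , zero)

  -- Rotation carries the edge leaving `inject₁ i` to the edge leaving `suc i`, so the claim
  -- descends from the edge leaving `last m`, whose deletion is `path`.
  C-∖-next : ∀ r → C (cycle ∖ (r , next r)) ≡ C path
  C-∖-next = >-weakInduction (λ r → C (cycle ∖ (r , next r)) ≡ C path)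
    (cong (λ s → C (cycle ∖ (last m , s))) (next-last m))
    (λ i hyp → trans
      (subst (λ r → C (cycle ∖ (inject₁ i , next (inject₁ i))) ≡ C (cycle ∖ (r , next r)))
        (next-inject₁ i)
        (C-iso rotation
          (∖-iso {G = cycle} {H = cycle} rotation (rotation-iso 3≤n) (inject₁ i) (next (inject₁ i)))))
      hyp)

  C-∖-edge : ∀ r s → Adj cycle r s → C (cycle ∖ (r , s)) ≡ C path
  C-∖-edge r s (inj₁ p) with refl ← Next⇒next p = C-∖-next r
  C-∖-edge r s (inj₂ p) with refl ← Next⇒next p =
    trans (C-∖-swap cycle r s) (C-∖-next s)

  path-step : suc (toℕ i) ≡ toℕ j → Adj path i j
  path-step {i} {j} eq = inj₁ (inj₁ eq) , λ where
    (inj₁ (_ , refl))    → contradiction eq λ ()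
    -- If 0 and the last vertex were consecutive, `m` would be 1, against `3 ≤ suc m`.
    (inj₂ (refl , refl)) → contradiction
      (subst (λ m → 3 ℕ.≤ suc m) (sym (trans eq (toℕ-fromℕ m))) 3≤n) λ { (s≤s (s≤s ())) }

  path-Adj : Adj path i j → suc (toℕ i) ≡ toℕ j ⊎ suc (toℕ j) ≡ toℕ i
  path-Adj (inj₁ (inj₁ p) , _) = inj₁ p
  path-Adj (inj₂ (inj₁ p) , _) = inj₂ p
  -- A wrap-around adjacency is the deleted edge in one of its orientations.
  path-Adj (inj₁ (inj₂ (p , q)) , ¬rs) = contradiction
    (inj₁ (toℕ-injective (trans (ℕ.suc-injective p) (sym (toℕ-fromℕ m))) , toℕ-injective q)) ¬rs
  path-Adj (inj₂ (inj₂ (p , q)) , ¬rs) = contradiction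
    (inj₂ (toℕ-injective q , toℕ-injective (trans (ℕ.suc-injective p) (sym (toℕ-fromℕ m))))) ¬rs

  -- Every step changes the label by exactly 1, so the triangle inequality for `∣_-_∣` bounds the
  -- length of any walk from below.
  path-distance : ∀ i j → IsDistance path i j ∣ toℕ i - toℕ j ∣
  path-distance i j = walk , λ _ → lower
    where
    walk : Walk path i j ∣ toℕ i - toℕ j ∣
    walk with ℕ.≤-total (toℕ i) (toℕ j)
    ... | inj₁ i≤j rewrite ℕ.m≤n⇒∣m-n∣≡n∸m i≤j =
            ascend path-step _ (ℕ.m+[n∸m]≡n i≤j)
    ... | inj₂ j≤i rewrite ℕ.m≤n⇒∣n-m∣≡n∸m j≤i =
            reverseWalk (ascend path-step _ (ℕ.m+[n∸m]≡n j≤i))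

    ∣n-1+n∣≡1 : ∀ n → ∣ n - suc n ∣ ≡ 1
    ∣n-1+n∣≡1 zero    = refl
    ∣n-1+n∣≡1 (suc n) = ∣n-1+n∣≡1 n

    step : ∀ {i j} → Adj path i j → ∣ toℕ i - toℕ j ∣ ≡ 1
    step {i} {j} a with path-Adj {i} {j} a
    ... | inj₁ p = trans (cong (∣ toℕ i -_∣) (sym p)) (∣n-1+n∣≡1 (toℕ i))
    ... | inj₂ p = trans (ℕ.∣-∣-comm (toℕ i) (toℕ j))
                     (trans (cong (∣ toℕ j -_∣) (sym p)) (∣n-1+n∣≡1 (toℕ j)))

    lower : ∀ {i j d} → Walk path i j d → ∣ toℕ i - toℕ j ∣ ℕ.≤ d
    lower {i} [] = ℕ.≤-reflexive (ℕ.m≡n⇒∣m-n∣≡0 {toℕ i} refl)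
    lower {i} {j} (_∷_ {j = k} a w) = ℕ.≤-trans
      (ℕ.∣-∣-triangle (toℕ i) (toℕ k) (toℕ j))
      (ℕ.+-mono-≤ (ℕ.≤-reflexive (step {i} {k} a)) (lower w))

  C-path : C path ≡ pathSum (suc m)
  C-path = sum-cong-≗ λ i → sum-cong-≗ λ j → pairCloseness-weight (path-distance i j)

  cycle-distance : ∀ i → IsDistance cycle i zero (toℕ i ⊓ (suc m ∸ toℕ i))
  cycle-distance i = walk , λ e w → bound (lower w)
    where
    walk : Walk cycle i zero (toℕ i ⊓ (suc m ∸ toℕ i))
    walk with ℕ.⊓-sel (toℕ i) (suc m ∸ toℕ i)
    ... | inj₁ eq rewrite eq = reverseWalk (ascend (inj₁ ∘ inj₁) (toℕ i) refl)
    -- The far arc climbs to the last vertex in `m ∸ toℕ i` steps and then takes the closing edge,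
    -- which accounts for the extra 1.
    ... | inj₂ eq rewrite eq | ℕ.+-∸-assoc 1 (toℕ≤pred[n] i) = snocWalk
            (ascend (inj₁ ∘ inj₁) (m ∸ toℕ i)
              (trans (ℕ.m+[n∸m]≡n (toℕ≤pred[n] i)) (sym (toℕ-fromℕ m))))
            (inj₁ (inj₂ (cong suc (toℕ-fromℕ m) , refl)))

    -- The disjuncts correspond to the two arcs to 0. Both survive prepending a step between
    -- consecutive labels; a first step across the closing edge settles one of them whatever the
    -- rest of the walk does.
    lower : ∀ {i d} → Walk cycle i zero d → toℕ i ℕ.≤ d ⊎ suc m ℕ.≤ toℕ i ℕ.+ d
    lower [] = inj₁ z≤n
    lower {i} {suc d} (a ∷ w) rewrite ℕ.+-suc (toℕ i) d with a | lower w
    ... | inj₁ (inj₁ p) | inj₁ le = inj₁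
            (ℕ.≤-trans (ℕ.n≤1+n _) (ℕ.≤-trans (ℕ.≤-reflexive p) (ℕ.m≤n⇒m≤1+n le)))
    ... | inj₁ (inj₁ p) | inj₂ le = inj₂ (subst (λ x → suc m ℕ.≤ x ℕ.+ d) (sym p) le)
    ... | inj₁ (inj₂ (p , _)) | _ = inj₂
            (subst (ℕ._≤ suc (toℕ i ℕ.+ d)) p (s≤s (ℕ.m≤m+n (toℕ i) d)))
    ... | inj₂ (inj₁ p) | inj₁ le = inj₁ (subst (ℕ._≤ suc d) p (s≤s le))
    ... | inj₂ (inj₁ p) | inj₂ le = inj₂ (ℕ.≤-trans le (ℕ.≤-trans
            (ℕ.+-monoˡ-≤ d (ℕ.≤-trans (ℕ.n≤1+n _) (ℕ.≤-reflexive p))) (ℕ.n≤1+n _)))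
    ... | inj₂ (inj₂ (_ , q)) | _ = inj₁ (subst (ℕ._≤ suc d) (sym q) z≤n)

    bound : ∀ {e} → toℕ i ℕ.≤ e ⊎ suc m ℕ.≤ toℕ i ℕ.+ e → toℕ i ⊓ (suc m ∸ toℕ i) ℕ.≤ e
    bound (inj₁ le) = ℕ.≤-trans (ℕ.m⊓n≤m _ _) le
    bound (inj₂ le) = ℕ.≤-trans (ℕ.m⊓n≤n (toℕ i) _) (ℕ.m≤n+o⇒m∸n≤o (suc m) (toℕ i) le)

  private
    column : Fin (suc m) → ℚ
    column j = sum λ i → pairCloseness cycle i j

  column-next : ∀ j → column j ≡ column (next j)
  column-next j = trans
    (sum-cong-≗ λ i → pairCloseness-iso {G = cycle} {H = cycle} rotation (rotation-iso 3≤n) i j)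
    (sym (sum-permute (λ i → pairCloseness cycle i (next j)) rotation))

  column-constant : ∀ j → column j ≡ column zero
  column-constant = <-weakInduction (λ j → column j ≡ column zero) refl λ i hyp →
    trans (sym (trans (column-next (inject₁ i)) (cong column (next-inject₁ i)))) hyp

  column-zero : column zero ≡ arcSum 1 m
  column-zero = trans
    (sum-cong-≗ λ i → pairCloseness-weight (cycle-distance i))
    -- Vertex 0 contributes `weight 0`, which is 0; the other summands are those of `arcSum 1 m` by
    -- computation.
    (+-identityˡ _)

  C-cycle : C cycle ≡ fromℕ (suc m) * arcSum 1 m
  C-cycle = begin
    -- The order of summation is exchanged because `cycle-distance` measures distances to 0, so
    -- columns are the sums at hand.
    C cycle                              ≡⟨ ∑-comm (pairCloseness cycle) ⟩
    sum column                           ≡⟨ sum-cong-≗ column-constant ⟩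
    sum {suc m} (λ _ → column zero)      ≡⟨ sum-const (suc m) (column zero) ⟩
    fromℕ (suc m) * column zero          ≡⟨ cong (fromℕ (suc m) *_) column-zero ⟩
    fromℕ (suc m) * arcSum 1 m           ∎
    where open ≡-Reasoning

-- The minimum over the links and the closed forms

-- The member `x` excludes the empty list, whose minimum is `nothing`; otherwise the minimum is the
-- head or a member of the tail.
minimum-constant : ∀ {c x} {xs : List ℚ} → x ∈ xs → All (_≡ c) xs → minimum xs ≡ just c
minimum-constant {xs = x ∷ xs} _ (refl ∷ all) with argmin-sel id x xs
... | inj₁ eq  = cong just eq
... | inj₂ min∈xs = cong just (All.lookup all min∈xs)

R-constant : ∀ {c} (G : Graph n) r s → Adj G r s →
             (∀ r s → Adj G r s → C (G ∖ (r , s)) ≡ c) → R G ≡ just c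
R-constant {n} G r s a const = minimum-constant
  (∈-map⁺ _ (∈-filter⁺ (uncurry (adj? G)) (∈-cartesianProduct⁺ (∈-allFin r) (∈-allFin s)) a))
  (All.map⁺ (All.map (λ {(r , s)} → const r s)
    (all-filter (uncurry (adj? G)) (cartesianProduct (allFin n) (allFin n)))))

R-H₂ : ∀ n 3≤n → R (H₂ n 3≤n) ≡ just (fromℕ 2 * fromℕ n - fromℕ 4 + fromℕ 4 * ½ ^ n)
R-H₂ (suc m) 3≤n = R-constant (H₂ (suc m) 3≤n) zero (next zero) (inj₁ (Next-next zero))
  λ r s a → trans (C-∖-edge 3≤n r s a) (trans (C-path 3≤n) (pathSum-closed (suc m)))

-- The equation `n ≡ suc m` is a hypothesis so that the lemma applies to `2 * k` and `2 * k + 1`,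
-- which do not compute to successors of the arc lengths wanted.
C-H₂ : ∀ n 3≤n → n ≡ suc m → C (H₂ n 3≤n) ≡ fromℕ n * arcSum 1 m
C-H₂ _ 3≤n refl = C-cycle 3≤n

C-H₂-even : ∀ k 3≤n → C (H₂ (2 ℕ.* k) 3≤n) ≡
            fromℕ (2 ℕ.* k) * (fromℕ 2 - fromℕ 3 * ½ ^ k)
C-H₂-even (suc t) 3≤n = trans
  (C-H₂ (2 ℕ.* suc t) 3≤n
    (cong suc (trans (ℕ.+-suc t (t ℕ.+ 0)) (cong (λ s → suc (t ℕ.+ s)) (ℕ.+-identityʳ t)))))
  (cong (fromℕ (2 ℕ.* suc t) *_) (arcSum-odd 0 t))

C-H₂-odd : ∀ k 3≤n → C (H₂ (2 ℕ.* k ℕ.+ 1) 3≤n) ≡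
           fromℕ (2 ℕ.* k ℕ.+ 1) * (fromℕ 2 * (1ℚ - ½ ^ k))
C-H₂-odd k 3≤n = trans
  (C-H₂ (2 ℕ.* k ℕ.+ 1) 3≤n
    (trans (ℕ.+-comm (2 ℕ.* k) 1) (cong (λ s → suc (k ℕ.+ s)) (ℕ.+-identityʳ k))))
  (cong (fromℕ (2 ℕ.* k ℕ.+ 1) *_) (arcSum-even 0 k))

theorem1 : ((k : ℕ) (2≤k : 2 ℕ.≤ k) →
    let G = H₂ (2 ℕ.* k) (3≤2k 2≤k) in
    R G ≡ just (C G - fromℕ 4 + 2^ (+ 2 ℤ.- + (2 ℕ.* k))
    + fromℕ (3 ℕ.* k) * 2^ (+ 1 ℤ.- + k)))
    ×
    ((k : ℕ) (1≤k : 1 ℕ.≤ k) →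
    let G = H₂ (2 ℕ.* k ℕ.+ 1) (3≤2k+1 1≤k) in
    R G ≡ just (C G - fromℕ 4 + 2^ (+ 1 ℤ.- + (2 ℕ.* k))
    + fromℕ (2 ℕ.* k ℕ.+ 1) * 2^ (+ 1 ℤ.- + k)))
theorem1 = even , odd
  where
  open +-*-Solver

  even : ∀ k (2≤k : 2 ℕ.≤ k) → let G = H₂ (2 ℕ.* k) (3≤2k 2≤k) in
    R G ≡ just (C G - fromℕ 4 + 2^ (+ 2 ℤ.- + (2 ℕ.* k)) + fromℕ (3 ℕ.* k) * 2^ (+ 1 ℤ.- + k))
  even k 2≤k
    rewrite R-H₂ (2 ℕ.* k) (3≤2k 2≤k) | C-H₂-even k (3≤2k 2≤k)
          | 2^[2-n] (2 ℕ.* k) | 2^[1-n] k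
          | fromℕ-homo-+ k (2 ℕ.* k) | fromℕ-homo-+ k (k ℕ.+ 0) | fromℕ-homo-+ k 0
    -- Each `con 0ℚ` is the `fromℕ 0` left at the end of the unfolded products `2 * k` and `3 * k`.
    -- The powers `½ ^ k` and `½ ^ (2 * k)` may be independent unknowns, since the terms in each
    -- match separately.
    = cong just (solve 3 (λ K x y →
        con (fromℕ 2) :* (K :+ (K :+ con 0ℚ)) :- con (fromℕ 4) :+ con (fromℕ 4) :* y
        := (K :+ (K :+ con 0ℚ)) :* (con (fromℕ 2) :- con (fromℕ 3) :* x)
             :- con (fromℕ 4) :+ con (fromℕ 4) :* y
             :+ (K :+ (K :+ (K :+ con 0ℚ))) :* (con (fromℕ 2) :* x))
        refl (fromℕ k) (½ ^ k) (½ ^ (2 ℕ.* k)))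

  odd : ∀ k (1≤k : 1 ℕ.≤ k) → let G = H₂ (2 ℕ.* k ℕ.+ 1) (3≤2k+1 1≤k) in
    R G ≡ just (C G - fromℕ 4 + 2^ (+ 1 ℤ.- + (2 ℕ.* k)) + fromℕ (2 ℕ.* k ℕ.+ 1) * 2^ (+ 1 ℤ.- + k))
  odd k 1≤k
    rewrite R-H₂ (2 ℕ.* k ℕ.+ 1) (3≤2k+1 1≤k) | C-H₂-odd k (3≤2k+1 1≤k)
          | 2^[1-n] (2 ℕ.* k) | 2^[1-n] k
          -- Rewriting only under `½ ^_` exposes a factor `½` and leaves `fromℕ (2 * k + 1)` intact
          -- as the unknown `N`.
          | cong (½ ^_) (ℕ.+-comm (2 ℕ.* k) 1)
    = cong just (solve 3 (λ N x y →
        con (fromℕ 2) :* N :- con (fromℕ 4) :+ con (fromℕ 4) :* (con ½ :* y)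
        := N :* (con (fromℕ 2) :* (con 1ℚ :- x)) :- con (fromℕ 4) :+ con (fromℕ 2) :* y
             :+ N :* (con (fromℕ 2) :* x))
        refl (fromℕ (2 ℕ.* k ℕ.+ 1)) (½ ^ k) (½ ^ (2 ℕ.* k)))
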